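{- For every integer $D$ with $0 \le D \le p$ (for the respective prime $p$), the following lower bounds hold: \[ W(3,\mathbb{Z}_5,D/5) \geq \frac{D^3 - 3D^2 + 2D}{6}, \] \[ W(3,\mathbb{Z}_7,D/7) \geq \frac{D^3 - 4D^2 + 3D}{8}, \] \[ W(3,\mathbb{Z}_{11},D/11) \geq \frac{\sqrt{5}D^3 + (15-12\sqrt{5})D^2 + (-15+11\sqrt{5})D}{30}, \] \[ W(3,\mathbb{Z}_{13},D/13) \geq \frac{21-2\sqrt{3}}{286}D^3 + \frac{28\sqrt{3}-151}{286}D^2 + \frac{5-\sqrt{3}}{11}D, \] \[ W(3,\mathbb{Z}_{17},D/17) \geq \frac{1}{24}D^3 - \frac{1}{4}D^2 + \frac{5}{24}D. \]
   Context: For a prime $p$, an arithmetic progression (A.P.) of length 3 in $\mathbb{Z}_p$ is a set of three distinct elements of the form $\{a, a+d, a+2d\}$ with $a \in \mathbb{Z}_p$, $d \in \mathbb{Z}_p\setminus\{0\}$; each such set is counted once. $W(3,\mathbb{Z}_p,D/p)$ denotes the minimum, over all subsets $S\subseteq\mathbb{Z}_p$ with $|S|=D$, of the number of 3-term A.P.s contained in $S$, i.e. $\min\{\sum_{\{i,j,k\}\text{ A.P. in }\mathbb{Z}_p} x_ix_jx_k : x_i\in\{0,1\}, \sum_{i=0}^{p-1}x_i = D\}$. -}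

module Defs where

open import Data.Nat using (ℕ; NonZero; _+_; _*_; _%_; _<_; _<?_)
open import Data.Nat.Properties using (_≟_)
open import Data.Fin using (Fin; toℕ)
open import Data.Fin.Subset using (Subset; _∈_)
open import Data.Fin.Subset.Properties using (_∈?_)
open import Data.List using (List; []; _∷_; concatMap; filter; length; allFin)
open import Data.Product using (_×_; _,_)
open import Data.Sum using (_⊎_)
open import Data.Integer as ℤ using (ℤ; +_)
open import Relation.Nullary using (Dec; yes; no)
open import Relation.Nullary.Decidable using (_×-dec_; _⊎-dec_)
open import Relation.Binary.PropositionalEquality using (_≡_)

-- Midpoint condition in ℤ_p (elements of ℤ_p are represented by Fin p):
-- y is the middle term of an A.P. with outer terms x and z, i.e. x + z ≡ 2y (mod p).
-- (Then {x,y,z} = {a, a+d, a+2d} with a = x, d = y - x.)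
Mid : (p : ℕ) .{{_ : NonZero p}} → Fin p → Fin p → Fin p → Set
Mid p x y z = (toℕ x + toℕ z) % p ≡ (2 * toℕ y) % p

mid? : (p : ℕ) .{{_ : NonZero p}} (x y z : Fin p) → Dec (Mid p x y z)
mid? p x y z = ((toℕ x + toℕ z) % p) ≟ ((2 * toℕ y) % p)

-- The 3-element set {i,j,k} is an A.P. {a, a+d, a+2d}, d ≠ 0,
-- iff one of its elements is the midpoint of the other two.
IsAP3 : (p : ℕ) .{{_ : NonZero p}} → Fin p → Fin p → Fin p → Set
IsAP3 p i j k = Mid p i j k ⊎ (Mid p j i k ⊎ Mid p i k j)

isAP3? : (p : ℕ) .{{_ : NonZero p}} (i j k : Fin p) → Dec (IsAP3 p i j k)
isAP3? p i j k = mid? p i j k ⊎-dec (mid? p j i k ⊎-dec mid? p i k j)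

triples : (p : ℕ) → List (Fin p × Fin p × Fin p)
triples p =
  concatMap (λ i → concatMap (λ j → concatMap (λ k → sel i j k) (allFin p)) (allFin p)) (allFin p)
  where
  sel : Fin p → Fin p → Fin p → List (Fin p × Fin p × Fin p)
  sel i j k with toℕ i <? toℕ j | toℕ j <? toℕ k
  ... | yes _ | yes _ = (i , j , k) ∷ []
  ... | _ | _ = []

apCount : (p : ℕ) .{{_ : NonZero p}} → Subset p → ℕ
apCount p S = length (filter dec (triples p))
  where
  dec : (t : Fin p × Fin p × Fin p) → Dec (let (i , j , k) = t in
          (i ∈ S × j ∈ S × k ∈ S) × IsAP3 p i j k)
  dec (i , j , k) = ((i ∈? S) ×-dec ((j ∈? S) ×-dec (k ∈? S))) ×-dec isAP3? p i j k

-- Comparison of an integer with a quadratic irrational: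
-- GeqSurd x a b n  means  x ≥ a + b·√n  (as real numbers).
-- With c = x - a: if b ≤ 0, this holds iff c ≥ 0 or c² ≤ n·b²;
-- if b ≥ 0, it holds iff c ≥ 0 and n·b² ≤ c².
GeqSurd : ℤ → ℤ → ℤ → ℕ → Set
GeqSurd x a b n =
  (b ℤ.≤ + 0 × ((+ 0 ℤ.≤ c) ⊎ (c ℤ.* c ℤ.≤ + n ℤ.* (b ℤ.* b))))
  ⊎ (+ 0 ℤ.≤ b × (+ 0 ℤ.≤ c) × (+ n ℤ.* (b ℤ.* b) ℤ.≤ c ℤ.* c))
  where
  c = x ℤ.- a

-- Every bound concerns a single prime p ≤ 17, so it is a finite statement about the
-- 2^p subsets of ℤ_p and is proved by exhaustive evaluation. To keep that feasible the
-- subsets are enumerated as a binary tree, one element decision per level: the A.P.s are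
-- stored as clauses (lists of elements) and, after fixing whether the next element lies
-- in S, each clause is either discarded or shortened, so at a leaf the number of A.P.s
-- inside S is just the number of clauses that survived.
module Submission where

open import Defs
open import Data.Bool using (Bool; true; false; T; T?; _∧_; if_then_else_)
open import Data.Bool.ListAction using (all)
open import Data.Bool.Properties using (T-∧; ∧-zeroʳ; ∧-identityʳ)
open import Data.Fin using (Fin; zero; suc)
open import Data.Fin.Subset using (Subset; _∈_; ∣_∣; inside; outside)
open import Data.Fin.Subset.Properties using (_∈?_)
open import Data.Integer using (ℤ; +_; _+_; _-_; _*_; -_)
import Data.Integer as ℤ
open import Data.List using (List; []; _∷_; length; filter; map; mapMaybe)
open import Data.Maybe using (Maybe; just; nothing; maybe)
import Data.Maybe as Maybe
open import Data.Nat as ℕ using (ℕ; zero; suc; NonZero; _≤_)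
open import Data.Nat.Properties using (+-identityʳ; +-suc)
open import Data.Product using (_×_; _,_; proj₁; proj₂)
open import Data.Vec using ([]; _∷_)
open import Function using (_∘_)
open import Function.Bundles using (Equivalence)
open import Relation.Binary.Definitions using (Decidable)
open import Relation.Binary.PropositionalEquality using (_≡_; refl; sym; cong; subst)
open import Relation.Nullary using (Dec; does)
open import Relation.Nullary.Decidable using (_×-dec_; _⊎-dec_; isYes; toWitness)

private
  variable
    n : ℕ

Clause : ℕ → Set
Clause n = List (Fin n)

holds : Clause n → Subset n → Bool
holds c S = all (λ i → does (i ∈? S)) c

satisfied : List (Clause n) → Subset n → ℕ
satisfied Cs S = length (filter (λ c → T? (holds c S)) Cs)

restrictClause : Bool → Clause (suc n) → Maybe (Clause n)
restrictClause b []          = just []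
restrictClause b (zero ∷ c)  = if b then restrictClause b c else nothing
restrictClause b (suc i ∷ c) = Maybe.map (i ∷_) (restrictClause b c)

restrict : Bool → List (Clause (suc n)) → List (Clause n)
restrict b = mapMaybe (restrictClause b)

holds-∷ : ∀ b (c : Clause (suc n)) S →
          holds c (b ∷ S) ≡ maybe (λ c′ → holds c′ S) false (restrictClause b c)
holds-∷ b         []          S = refl
holds-∷ true      (zero ∷ c)  S = holds-∷ true c S
holds-∷ false     (zero ∷ c)  S = refl
holds-∷ b         (suc i ∷ c) S with restrictClause b c | holds-∷ b c S
... | nothing | eq rewrite eq = ∧-zeroʳ (does (i ∈? S))
... | just c′ | eq = cong (does (i ∈? S) ∧_) eq

satisfied-restrict : ∀ b (Cs : List (Clause (suc n))) S →
                     satisfied (restrict b Cs) S ≡ satisfied Cs (b ∷ S)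
satisfied-restrict b []       S = refl
satisfied-restrict b (c ∷ Cs) S with restrictClause b c | holds-∷ b c S
... | nothing | eq rewrite eq = satisfied-restrict b Cs S
... | just c′ | eq rewrite eq with holds c′ S
...   | true  = cong suc (satisfied-restrict b Cs S)
...   | false = satisfied-restrict b Cs S

satisfied-[] : (Cs : List (Clause 0)) → satisfied Cs [] ≡ length Cs
satisfied-[] []       = refl
satisfied-[] ([] ∷ Cs) = cong suc (satisfied-[] Cs)

module _ {P : ℕ → ℕ → Set} (P? : Decidable P) where

  allSubsets? : (k d : ℕ) → List (Clause k) → Bool
  allSubsets? zero    d Cs = isYes (P? d (length Cs))
  allSubsets? (suc k) d Cs =
    allSubsets? k d (restrict false Cs) ∧ allSubsets? k (suc d) (restrict true Cs)

  allSubsets?-split : ∀ k d (Cs : List (Clause (suc k))) → T (allSubsets? (suc k) d Cs) →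
                      T (allSubsets? k d (restrict false Cs)) × T (allSubsets? k (suc d) (restrict true Cs))
  allSubsets?-split k d Cs = Equivalence.to (T-∧ {allSubsets? k d (restrict false Cs)})

  -- d counts the elements already placed in S above the current level.
  allSubsets?-sound : ∀ k d (Cs : List (Clause k)) → T (allSubsets? k d Cs) →
                      (S : Subset k) → P (d ℕ.+ ∣ S ∣) (satisfied Cs S)
  allSubsets?-sound zero d Cs ok [] rewrite +-identityʳ d | satisfied-[] Cs = toWitness ok
  allSubsets?-sound (suc k) d Cs ok (outside ∷ S) =
    subst (P (d ℕ.+ ∣ S ∣)) (satisfied-restrict false Cs S)
      (allSubsets?-sound k d (restrict false Cs) (proj₁ (allSubsets?-split k d Cs ok)) S)
  allSubsets?-sound (suc k) d Cs ok (inside ∷ S) rewrite +-suc d ∣ S ∣ =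
    subst (P (suc d ℕ.+ ∣ S ∣)) (satisfied-restrict true Cs S)
      (allSubsets?-sound k (suc d) (restrict true Cs) (proj₂ (allSubsets?-split k d Cs ok)) S)

Triple : ℕ → Set
Triple p = Fin p × Fin p × Fin p

module _ (p : ℕ) .{{_ : NonZero p}} where

  apTriple? : (t : Triple p) → Dec (let (i , j , k) = t in IsAP3 p i j k)
  apTriple? (i , j , k) = isAP3? p i j k

  apClauses : List (Triple p) → List (Clause p)
  apClauses = map (λ (i , j , k) → i ∷ j ∷ k ∷ []) ∘ filter apTriple?

  apTripleIn? : (S : Subset p) (t : Triple p) →
                Dec (let (i , j , k) = t in (i ∈ S × j ∈ S × k ∈ S) × IsAP3 p i j k)
  apTripleIn? S (i , j , k) = ((i ∈? S) ×-dec ((j ∈? S) ×-dec (k ∈? S))) ×-dec isAP3? p i j k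

  length-filter-apTripleIn : ∀ S (ts : List (Triple p)) →
    length (filter (apTripleIn? S) ts) ≡ satisfied (apClauses ts) S
  length-filter-apTripleIn S [] = refl
  length-filter-apTripleIn S ((i , j , k) ∷ ts) with does (isAP3? p i j k)
  ... | false rewrite ∧-zeroʳ (does (i ∈? S) ∧ (does (j ∈? S) ∧ does (k ∈? S))) =
    length-filter-apTripleIn S ts
  ... | true rewrite ∧-identityʳ (does (k ∈? S))
                   | ∧-identityʳ (does (i ∈? S) ∧ (does (j ∈? S) ∧ does (k ∈? S)))
                   with does (i ∈? S) ∧ (does (j ∈? S) ∧ does (k ∈? S))
  ...   | true  = cong suc (length-filter-apTripleIn S ts)
  ...   | false = length-filter-apTripleIn S ts

  apCount≡satisfied : ∀ S → apCount p S ≡ satisfied (apClauses (triples p)) S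
  apCount≡satisfied S = length-filter-apTripleIn S (triples p)

  apCount-bound : {P : ℕ → ℕ → Set} (P? : Decidable P) →
                  T (allSubsets? P? p 0 (apClauses (triples p))) →
                  ∀ D → D ≤ p → (S : Subset p) → ∣ S ∣ ≡ D → P D (apCount p S)
  apCount-bound {P} P? ok _ _ S refl =
    subst (P ∣ S ∣) (sym (apCount≡satisfied S))
      (allSubsets?-sound P? p 0 (apClauses (triples p)) ok S)

geqSurd? : (x a b : ℤ) (n : ℕ) → Dec (GeqSurd x a b n)
geqSurd? x a b n =
  ((b ℤ.≤? + 0) ×-dec ((+ 0 ℤ.≤? c) ⊎-dec (c * c ℤ.≤? + n * (b * b))))
  ⊎-dec ((+ 0 ℤ.≤? b) ×-dec ((+ 0 ℤ.≤? c) ×-dec (+ n * (b * b) ℤ.≤? c * c)))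
  where c = x - a

theorem2 :
    (∀ (D : ℕ) → D ≤ 5 → (S : Subset 5) → ∣ S ∣ ≡ D →
      (+ D * + D * + D) - + 3 * (+ D * + D) + + 2 * + D
        Data.Integer.≤ + 6 * + apCount 5 S)
    × (∀ (D : ℕ) → D ≤ 7 → (S : Subset 7) → ∣ S ∣ ≡ D →
      (+ D * + D * + D) - + 4 * (+ D * + D) + + 3 * + D
        Data.Integer.≤ + 8 * + apCount 7 S)
    × (∀ (D : ℕ) → D ≤ 11 → (S : Subset 11) → ∣ S ∣ ≡ D →
      GeqSurd (+ 30 * + apCount 11 S)
              (+ 15 * (+ D * + D) - + 15 * + D)
              ((+ D * + D * + D) - + 12 * (+ D * + D) + + 11 * + D)
              5)
    × (∀ (D : ℕ) → D ≤ 13 → (S : Subset 13) → ∣ S ∣ ≡ D →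
      GeqSurd (+ 286 * + apCount 13 S)
              (+ 21 * (+ D * + D * + D) - + 151 * (+ D * + D) + + 130 * + D)
              (- (+ 2 * (+ D * + D * + D)) + + 28 * (+ D * + D) - + 26 * + D)
              3)
    × (∀ (D : ℕ) → D ≤ 17 → (S : Subset 17) → ∣ S ∣ ≡ D →
      (+ D * + D * + D) - + 6 * (+ D * + D) + + 5 * + D
        Data.Integer.≤ + 24 * + apCount 17 S)
theorem2 =
    apCount-bound 5 (λ D n → (+ D * + D * + D) - + 3 * (+ D * + D) + + 2 * + D ℤ.≤? + 6 * + n) _
  , apCount-bound 7 (λ D n → (+ D * + D * + D) - + 4 * (+ D * + D) + + 3 * + D ℤ.≤? + 8 * + n) _
  , apCount-bound 11 (λ D n → geqSurd? (+ 30 * + n)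
                                       (+ 15 * (+ D * + D) - + 15 * + D)
                                       ((+ D * + D * + D) - + 12 * (+ D * + D) + + 11 * + D)
                                       5) _
  , apCount-bound 13 (λ D n → geqSurd? (+ 286 * + n)
                                       (+ 21 * (+ D * + D * + D) - + 151 * (+ D * + D) + + 130 * + D)
                                       (- (+ 2 * (+ D * + D * + D)) + + 28 * (+ D * + D) - + 26 * + D)
                                       3) _
  , apCount-bound 17 (λ D n → (+ D * + D * + D) - + 6 * (+ D * + D) + + 5 * + D ℤ.≤? + 24 * + n) _
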